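{- Let $n\ge 1$ be an integer, and suppose the kernel of the game of size $n$ has exactly $k$ elements. Then every configuration of the game of size $n$ that has a solution has exactly $k$ solutions. In particular, if $k > 1$, there exist configurations with no solution.
   Context: For an integer $n\ge 1$, the (triangular Lights Out) game of size $n$ is played on a triangular arrangement of $\beta = n(n+1)/2$ circles ("buttons") with side length $n$: row $r$ ($1\le r\le n$, from top to bottom) contains $r$ buttons, and circles touch as in the usual triangular packing. In coordinates, the buttons are the pairs $(r,s)$ with $1\le s\le r\le n$, and the neighbors of $(r,s)$ (the circles tangent to it) are those among $(r,s-1),(r,s+1),(r-1,s-1),(r-1,s),(r+1,s),(r+1,s+1)$ that belong to the arrangement. Each button is either lit or unlit; a configuration is identified with the set $C$ of lit buttons. Pressing a button switches the state of that button and of all of its neighbors. Since the order of presses is irrelevant and pressing a button twice has no effect, a move is described by a set $X$ of buttons, each pressed once; $C \xrightarrow{X} D$ means that pressing the buttons of $X$ starting from configuration $C$ yields configuration $D$. A set of buttons $X$ is a solution for a configuration $C$ if $C \xrightarrow{X} \emptyset$, i.e. pressing the buttons in $X$ starting from $C$ turns all buttons off. Solutions are counted as sets of buttons. A set of buttons $X$ is a null sequence if $C \xrightarrow{X} C$ for every configuration $C$. The kernel of the game is the set of all null sequences. -}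

module Defs where

open import Data.Bool.Base using (not; if_then_else_)
open import Data.Fin.Base using (Fin; toℕ; fromℕ<; join; _↑ˡ_; _↑ʳ_; splitAt)
import Data.Fin.Properties as Fin
open import Data.Fin.Subset using (Subset; ⊥)
open import Data.Fin.Subset.Properties using (_∈?_)
open import Data.List.Base using (List; []; _∷_; length; foldl; filter; allFin)
open import Data.List.Membership.Propositional using (_∈_)
import Data.List.Membership.DecPropositional as DecMembership
open import Data.List.Relation.Unary.Unique.Propositional using (Unique)
open import Data.Nat.Base using (ℕ; zero; suc; _+_; _*_; _∸_; _≤_; z≤n; s≤s)
import Data.Nat.Properties as ℕ
open import Data.Nat.Tactic.RingSolver using (solve-∀)
open import Data.Product.Base using (_×_; _,_; ∃; proj₁; proj₂)
open import Data.Product.Properties using (≡-dec)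
open import Data.Sum.Base using (_⊎_; inj₁; inj₂; [_,_]′)
open import Data.Vec.Base using (lookup; tabulate)
open import Function.Bundles using (_⇔_)
open import Level using (0ℓ; _⊔_)
open import Relation.Binary.PropositionalEquality
  using (_≡_; refl; sym; trans; cong; cong₂; subst)
open import Relation.Nullary using (Dec; yes; no; does; contradiction)
open import Relation.Nullary.Decidable using (_⊎-dec_)
open import Relation.Unary using (Pred)

-- 1 + 2 + ⋯ + n; the closed form is 2*β below.
β : ℕ → ℕ
β zero    = 0
β (suc n) = β n + suc n

-- Buttons are numbered row by row from the top, left to right in each row,
-- so that a set of buttons is a library Subset, with _≡_ as its equality.
Button : ℕ → Set
Button n = Fin (β n)

-- The coordinates (r , s), starting from 1. The lemmas coords-bounds,
-- coords-injective and coords-surjective below show that coords enumerates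
-- the pairs with 1 ≤ s ≤ r ≤ n, each exactly once.
coords : ∀ n → Button n → ℕ × ℕ
coords (suc n) b =
  [ coords n , (λ s → suc n , suc (toℕ s)) ]′ (splitAt (β n) b)

-- On buttons r and s are positive, so _∸ 1 does not truncate. Pairs lying
-- outside the arrangement are harmless: they are the coordinates of no button.
around : ℕ × ℕ → List (ℕ × ℕ)
around (r , s) =
    (r     , s ∸ 1) ∷ (r     , s + 1)
  ∷ (r ∸ 1 , s ∸ 1) ∷ (r ∸ 1 , s)
  ∷ (r + 1 , s)     ∷ (r + 1 , s + 1) ∷ []

HasExactly : ∀ {a p} {A : Set a} → ℕ → Pred A p → Set (a ⊔ p)
HasExactly k P = ∃ λ xs → Unique xs × length xs ≡ k × (∀ x → x ∈ xs ⇔ P x)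

2*β : ∀ n → 2 * β n ≡ n * (n + 1)
2*β zero    = refl
2*β (suc n) = trans (ℕ.*-distribˡ-+ 2 (β n) (suc n))
             (trans (cong (_+ 2 * suc n) (2*β n)) (step n))
  where
  step : ∀ m → m * (m + 1) + 2 * (1 + m) ≡ (1 + m) * ((1 + m) + 1)
  step = solve-∀

coords-bounds : ∀ n (b : Button n) → let (r , s) = coords n b in
                1 ≤ s × s ≤ r × r ≤ n
coords-bounds (suc n) b with splitAt (β n) b
... | inj₂ s = s≤s z≤n , Fin.toℕ<n s , ℕ.≤-refl
... | inj₁ c with 1≤s , s≤r , r≤n ← coords-bounds n c = 1≤s , s≤r , ℕ.m≤n⇒m≤1+n r≤n

coords-injective : ∀ n (b c : Button n) → coords n b ≡ coords n c → b ≡ c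
coords-injective (suc n) b c eq =
  trans (sym (Fin.join-splitAt (β n) (suc n) b))
 (trans (cong (join (β n) (suc n)) (split≡ (splitAt (β n) b) (splitAt (β n) c) eq))
        (Fin.join-splitAt (β n) (suc n) c))
  where
  at : Button n ⊎ Fin (suc n) → ℕ × ℕ
  at = [ coords n , (λ s → suc n , suc (toℕ s)) ]′

  old≢new : ∀ d {s} → coords n d ≡ (suc n , s) → ∀ {A : Set} → A
  old≢new d e = contradiction
    (subst (_≤ n) (cong proj₁ e) (proj₂ (proj₂ (coords-bounds n d)))) ℕ.1+n≰n

  split≡ : ∀ x y → at x ≡ at y → x ≡ y
  split≡ (inj₁ d) (inj₁ e) h = cong inj₁ (coords-injective n d e h)
  split≡ (inj₁ d) (inj₂ s) h = old≢new d h
  split≡ (inj₂ s) (inj₁ d) h = old≢new d (sym h)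
  split≡ (inj₂ s) (inj₂ t) h =
    cong inj₂ (Fin.toℕ-injective (ℕ.suc-injective (cong proj₂ h)))

coords-surjective : ∀ n {r s} → 1 ≤ s → s ≤ r → r ≤ n →
                    ∃ λ (b : Button n) → coords n b ≡ (r , s)
coords-surjective zero    1≤s s≤r r≤n = contradiction (ℕ.≤-trans 1≤s (ℕ.≤-trans s≤r r≤n)) λ ()
coords-surjective (suc n) {r} {suc s} 1≤s s≤r r≤n with r ℕ.≟ suc n
... | yes refl = β n ↑ʳ fromℕ< s≤r ,
      trans (cong [ coords n , _ ]′ (Fin.splitAt-↑ʳ (β n) (suc n) (fromℕ< s≤r)))
            (cong₂ _,_ refl (cong suc (Fin.toℕ-fromℕ< s≤r)))
... | no r≢1+n with b , eq ← coords-surjective n 1≤s s≤r (ℕ.≤-pred (ℕ.≤∧≢⇒< r≤n r≢1+n)) =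
      b ↑ˡ suc n ,
      trans (cong [ coords n , _ ]′ (Fin.splitAt-↑ˡ (β n) b (suc n))) eq

module Game (n : ℕ) where

  Neighbour : Button n → Button n → Set
  Neighbour b c = coords n c ∈ around (coords n b)

  neighbour? : ∀ b c → Dec (Neighbour b c)
  neighbour? b c = coords n c ∈ℕ²? around (coords n b)
    where open DecMembership (≡-dec ℕ._≟_ ℕ._≟_) renaming (_∈?_ to _∈ℕ²?_)

  ButtonSet : Set
  ButtonSet = Subset (β n)

  -- A configuration is identified with its set of lit buttons.
  Configuration : Set
  Configuration = ButtonSet

  pressButton : Configuration → Button n → Configuration
  pressButton C b = tabulate λ c →
    if does ((c Fin.≟ b) ⊎-dec neighbour? b c)
    then not (lookup C c)
    else lookup C c

  -- Each button of X is pressed once. The order of the presses is irrelevant;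
  -- here it is the order of the numbering.
  press : ButtonSet → Configuration → Configuration
  press X C = foldl pressButton C (filter (_∈? X) (allFin (β n)))

  infix 4 _—[_]→_

  _—[_]→_ : Configuration → ButtonSet → Configuration → Set
  C —[ X ]→ D = press X C ≡ D

  SolutionOf : Configuration → Pred ButtonSet 0ℓ
  SolutionOf C X = C —[ X ]→ ⊥

  Solvable : Configuration → Set
  Solvable C = ∃ (SolutionOf C)

  Kernel : Pred ButtonSet 0ℓ
  Kernel X = ∀ C → C —[ X ]→ C

{-# OPTIONS --safe #-}
module Submission where

-- Pressing X adds to the configuration, in the group of subsets under
-- symmetric difference, a set effect X that depends additively on X. The
-- kernel is therefore the kernel of effect, and the solutions of a solvable
-- configuration form a coset of it. If the kernel is nontrivial, effect is
-- not injective, hence not surjective on the finite set of configurations.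

open import Defs
open import Data.Nat.Base using (ℕ; _≥_; _>_)
open import Data.Product.Base using (_×_; ∃)
open import Relation.Nullary using (¬_)

open import Algebra.Bundles using (AbelianGroup)
import Algebra.Properties.AbelianGroup as AbelianGroupProperties
import Algebra.Properties.CommutativeSemigroup as CommutativeSemigroupProperties
open import Data.Bool.Base using (Bool; true; false; not; _xor_; if_then_else_)
open import Data.Bool.Properties
  using (_≟_; ¬-not; xor-assoc; xor-comm; xor-identityˡ; xor-identityʳ; xor-same)
open import Data.Fin.Base using (Fin; zero; suc; punchOut)
import Data.Fin.Properties as Fin
open import Data.Fin.Subset using (Subset; ⊥)
open import Data.Fin.Subset.Properties using (_∈?_; anySubset?)
open import Data.List.Base using (List; []; _∷_; map; foldl; filter; allFin)
open import Data.List.Membership.Propositional using (_∈_)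
open import Data.List.Membership.Propositional.Properties using (∈-map⁺; ∈-map⁻)
open import Data.List.Properties using (length-map)
open import Data.List.Relation.Unary.All using (_∷_)
open import Data.List.Relation.Unary.AllPairs using (_∷_)
open import Data.List.Relation.Unary.Any using (here; there)
open import Data.List.Relation.Unary.Unique.Propositional.Properties using (map⁺)
open import Data.Nat.Base using (suc; _^_; s≤s)
import Data.Nat.Properties as ℕ
open import Data.Product.Base using (_,_; proj₁; proj₂; uncurry)
open import Data.Product.Function.NonDependent.Propositional using (_×-↔_)
open import Data.Vec.Base using ([]; _∷_; zipWith; lookup; tabulate; uncons)
open import Data.Vec.Properties
  using ( ≡-dec; zipWith-assoc; zipWith-comm; zipWith-identityˡ; zipWith-identityʳ
        ; lookup-zipWith; lookup∘tabulate; tabulate∘lookup; tabulate-cong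
        ; lookup⇒[]=; []=⇒lookup)
open import Function.Base using (id; _∘_)
open import Function.Bundles using (_↔_; _⇔_; Inverse; Injection; Equivalence; mk⇔; mk↔ₛ′)
open import Function.Definitions using (Injective; StrictlySurjective)
open import Function.Properties.Inverse using (↔-sym; ↔-trans; ↔⇒↣)
open import Level using (0ℓ)
open import Relation.Binary.PropositionalEquality
  using (_≡_; refl; sym; trans; cong; cong₂; subst; isEquivalence; module ≡-Reasoning)
open import Relation.Nullary using (yes; no; does; ¬?; contradiction)
open import Relation.Nullary.Decidable using (_⊎-dec_; decidable-stable)
open import Relation.Unary using (Decidable; Pred)

-- Injectivity of the bijection keeps the mapped list free of repetitions, and its inverse shows
-- that no element of `Q` is missed. This carries the count of the kernel over to the solutions.
HasExactly-↔ : ∀ {a b p q} {A : Set a} {B : Set b} {P : Pred A p} {Q : Pred B q} {k}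
               (A↔B : A ↔ B) → (∀ x → P x ⇔ Q (Inverse.to A↔B x)) →
               HasExactly k P → HasExactly k Q
HasExactly-↔ {Q = Q} A↔B P⇔Q (xs , unique , len , ∈⇔P) =
  map to xs , map⁺ (Injection.injective (↔⇒↣ A↔B)) unique ,
  trans (length-map to xs) len , λ y → mk⇔ (sound y) (complete y)
  where
  open Inverse A↔B using (to; from; strictlyInverseˡ)

  sound : ∀ y → y ∈ map to xs → Q y
  sound y y∈ with x , x∈xs , refl ← ∈-map⁻ to y∈ =
    Equivalence.to (P⇔Q x) (Equivalence.to (∈⇔P x) x∈xs)

  complete : ∀ y → Q y → y ∈ map to xs
  complete y Qy = subst (_∈ map to xs) (strictlyInverseˡ y)
    (∈-map⁺ to (Equivalence.from (∈⇔P (from y))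
      (Equivalence.from (P⇔Q (from y)) (subst Q (sym (strictlyInverseˡ y)) Qy))))

-- Pigeonhole: if `y` were missed, punching `y` out of the codomain would give an injection from
-- `Fin (suc n)` into `Fin n`.
Fin-injective⇒surjective : ∀ {n} {f : Fin n → Fin n} →
                           Injective _≡_ _≡_ f → StrictlySurjective _≡_ f
Fin-injective⇒surjective {suc n} {f} inj y with Fin.any? (λ i → f i Fin.≟ y)
... | yes hit  = hit
... | no  miss = contradiction
  (Fin.injective⇒≤ {f = λ i → punchOut (y≢f i)}
    (λ {i} {j} eq → inj (Fin.punchOut-injective (y≢f i) (y≢f j) eq)))
  ℕ.1+n≰n
  where
  y≢f : ∀ i → ¬ y ≡ f i
  y≢f i eq = miss (i , sym eq)

-- Surjectivity provides a section `g` of `f`. A section is injective, hence surjective by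
-- pigeonhole, so `g` is a two-sided inverse of `f`.
finite-surjective⇒injective : ∀ {a n} {A : Set a} {f : A → A} → A ↔ Fin n →
                              StrictlySurjective _≡_ f → Injective _≡_ _≡_ f
finite-surjective⇒injective {A = A} {f} A↔Fin surj {x} {y} fx≡fy = begin
  x              ≡⟨ g-inverseˡ x ⟨
  g (f x)        ≡⟨ cong g fx≡fy ⟩
  g (f y)        ≡⟨ g-inverseˡ y ⟩
  y              ∎
  where
  open ≡-Reasoning
  open Inverse A↔Fin using (to; from; strictlyInverseˡ; strictlyInverseʳ)

  g : A → A
  g = proj₁ ∘ surj

  g-injective : Injective _≡_ _≡_ g
  g-injective {u} {v} eq = trans (sym (proj₂ (surj u))) (trans (cong f eq) (proj₂ (surj v)))

  g-surjective : StrictlySurjective _≡_ g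
  g-surjective z =
    -- Pigeonhole is applied to the conjugate of `g` on `Fin n`.
    let i , eq = Fin-injective⇒surjective {f = to ∘ g ∘ from}
                   (Injection.injective (↔⇒↣ (↔-sym A↔Fin)) ∘ g-injective
                     ∘ Injection.injective (↔⇒↣ A↔Fin)) (to z)
    in from i , Injection.injective (↔⇒↣ A↔Fin) eq

  g-inverseˡ : ∀ z → g (f z) ≡ z
  -- Writing `z` as `g u` reduces the claim to `f (g u) ≡ u`.
  g-inverseˡ z with u , refl ← g-surjective z = cong g (proj₂ (surj u))

Subset↔Fin : ∀ m → Subset m ↔ Fin (2 ^ m)
Subset↔Fin 0       = mk↔ₛ′ (λ _ → zero) (λ _ → []) (λ { zero → refl ; (suc ()) }) (λ { [] → refl })
Subset↔Fin (suc m) =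
  ↔-trans (mk↔ₛ′ uncons (uncurry _∷_) (λ _ → refl) (λ { (_ ∷ _) → refl }))
 (↔-trans (↔-sym Fin.2↔Bool ×-↔ Subset↔Fin m)
          (↔-sym Fin.*↔×))

-- The additive group of the vector space of dimension `m` over the field with two elements; every
-- element is its own inverse.
xor-abelianGroup : ℕ → AbelianGroup 0ℓ 0ℓ
xor-abelianGroup m = record
  { Carrier        = Subset m
  ; _≈_            = _≡_
  ; _∙_            = zipWith _xor_
  ; ε              = ⊥
  ; _⁻¹            = id
  ; isAbelianGroup = record
    { isGroup = record
      { isMonoid = record
        { isSemigroup = record
          { isMagma = record { isEquivalence = isEquivalence ; ∙-cong = cong₂ _ }
          ; assoc   = zipWith-assoc xor-assoc
          }
        ; identity = zipWith-identityˡ xor-identityˡ , zipWith-identityʳ xor-identityʳ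
        }
      ; inverse = self-inverse , self-inverse
      ; ⁻¹-cong = id
      }
    ; comm = zipWith-comm xor-comm
    }
  }
  where
  self-inverse : ∀ {m} (X : Subset m) → zipWith _xor_ X X ≡ ⊥
  self-inverse []      = refl
  self-inverse (x ∷ X) = cong₂ _∷_ (xor-same x) (self-inverse X)

module _ {m : ℕ} where
  open AbelianGroup (xor-abelianGroup m) public
    using () renaming (_∙_ to infixl 6 _⊕_; assoc to ⊕-assoc; identityˡ to ⊕-identityˡ;
                       identityʳ to ⊕-identityʳ; inverseˡ to ⊕-self)
  open AbelianGroupProperties (xor-abelianGroup m) public
    using () renaming (inverseʳ-unique to ⊕≡⊥⇒≡; identityʳ-unique to ⊕-identityʳ-unique)
  open CommutativeSemigroupProperties
    (AbelianGroup.commutativeSemigroup (xor-abelianGroup m)) public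
    using () renaming (interchange to ⊕-interchange)

⊕-cancelˡ : ∀ {m} (X Y : Subset m) → X ⊕ (X ⊕ Y) ≡ Y
⊕-cancelˡ X Y = begin
  X ⊕ (X ⊕ Y)  ≡⟨ ⊕-assoc X X Y ⟨
  X ⊕ X ⊕ Y    ≡⟨ cong (_⊕ Y) (⊕-self X) ⟩
  ⊥ ⊕ Y        ≡⟨ ⊕-identityˡ Y ⟩
  Y            ∎
  where open ≡-Reasoning

⊕-↔ : ∀ {m} → Subset m → Subset m ↔ Subset m
⊕-↔ X = mk↔ₛ′ (X ⊕_) (X ⊕_) (⊕-cancelˡ X) (⊕-cancelˡ X)

-- Scalar multiplication over the field with two elements.
when : ∀ {m} → Bool → Subset m → Subset m
when b X = if b then X else ⊥

when-xor : ∀ {m} a b (X : Subset m) → when (a xor b) X ≡ when a X ⊕ when b X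
when-xor false b     X = sym (⊕-identityˡ _)
when-xor true  false X = sym (⊕-identityʳ X)
when-xor true  true  X = sym (⊕-self X)

module _ (n : ℕ) where
  open Game n

  reach : Button n → ButtonSet
  reach b = tabulate λ c → does ((c Fin.≟ b) ⊎-dec neighbour? b c)

  pressButton≡⊕ : ∀ C b → pressButton C b ≡ C ⊕ reach b
  pressButton≡⊕ C b =
    trans (tabulate-cong pointwise) (tabulate∘lookup (C ⊕ reach b))
    where
    if-not : ∀ d x → (if d then not x else x) ≡ x xor d
    if-not false x = xor-comm false x
    if-not true  x = xor-comm true x

    pointwise : ∀ c → (if does ((c Fin.≟ b) ⊎-dec neighbour? b c)
                       then not (lookup C c) else lookup C c)
                      ≡ lookup (C ⊕ reach b) c
    pointwise c = trans (if-not _ (lookup C c))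
      (trans (cong (lookup C c xor_) (sym (lookup∘tabulate _ c)))
             (sym (lookup-zipWith _xor_ c C (reach b))))

  -- The linear combination of the sets `reach b` with the indicator of `X` as coefficients. The
  -- list is a parameter so that inductions can follow the fold in `press`.
  effectOn : List (Button n) → ButtonSet → Configuration
  effectOn []       X = ⊥
  effectOn (b ∷ bs) X = when (lookup X b) (reach b) ⊕ effectOn bs X

  effect : ButtonSet → Configuration
  effect = effectOn (allFin (β n))

  effectOn-⊕ : ∀ bs X Y → effectOn bs (X ⊕ Y) ≡ effectOn bs X ⊕ effectOn bs Y
  effectOn-⊕ []       X Y = sym (⊕-identityˡ ⊥)
  effectOn-⊕ (b ∷ bs) X Y = trans
    (cong₂ _⊕_ (trans (cong (λ x → when x (reach b)) (lookup-zipWith _xor_ b X Y))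
                      (when-xor (lookup X b) (lookup Y b) (reach b)))
               (effectOn-⊕ bs X Y))
    (⊕-interchange _ _ _ _)

  press≡⊕ : ∀ X C → press X C ≡ C ⊕ effect X
  press≡⊕ X = foldl≡⊕ (allFin (β n))
    where
    foldl≡⊕ : ∀ bs C → foldl pressButton C (filter (_∈? X) bs) ≡ C ⊕ effectOn bs X
    foldl≡⊕ []       C = sym (⊕-identityʳ C)
    foldl≡⊕ (b ∷ bs) C with b ∈? X
    -- The rewrite makes the coefficient of `reach b` compute to `true`; in the other case it
    -- becomes `false` and the summand is `⊥`.
    ... | yes b∈X rewrite []=⇒lookup b∈X = begin
      foldl pressButton (pressButton C b) (filter (_∈? X) bs)
        ≡⟨ foldl≡⊕ bs (pressButton C b) ⟩
      pressButton C b ⊕ effectOn bs X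
        ≡⟨ cong (_⊕ effectOn bs X) (pressButton≡⊕ C b) ⟩
      C ⊕ reach b ⊕ effectOn bs X
        ≡⟨ ⊕-assoc C (reach b) (effectOn bs X) ⟩
      C ⊕ (reach b ⊕ effectOn bs X)
        ∎
      where open ≡-Reasoning
    ... | no b∉X rewrite ¬-not (b∉X ∘ lookup⇒[]= b X) =
      trans (foldl≡⊕ bs C) (cong (C ⊕_) (sym (⊕-identityˡ _)))

  -- Every press is a translation by `effect X`, so fixing the single configuration `⊥` already
  -- forces `effect X` to vanish.
  kernel⇔ : ∀ X → Kernel X ⇔ effect X ≡ ⊥
  kernel⇔ X = mk⇔
    (λ null → ⊕-identityʳ-unique ⊥ (effect X) (trans (sym (press≡⊕ X ⊥)) (null ⊥)))
    (λ eq C → trans (press≡⊕ X C) (trans (cong (C ⊕_) eq) (⊕-identityʳ C)))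

  -- Since `C` is its own inverse, `C ⊕ effect X` is empty exactly when `effect X` equals `C`.
  solution⇔ : ∀ C X → SolutionOf C X ⇔ effect X ≡ C
  solution⇔ C X = mk⇔
    (λ sol → ⊕≡⊥⇒≡ C (effect X) (trans (sym (press≡⊕ X C)) sol))
    (λ { refl → trans (press≡⊕ X (effect X)) (⊕-self (effect X)) })

  -- By additivity `effect (X ⊕ Z)` is `C ⊕ effect Z`, which equals `C` exactly when `effect Z`
  -- vanishes. So translation by `X` matches the kernel with the solutions of `C`.
  kernel⇔solution : ∀ {C X} → SolutionOf C X → ∀ Z → Kernel Z ⇔ SolutionOf C (X ⊕ Z)
  kernel⇔solution {C} {X} sol Z = mk⇔
    (λ null → from (solution⇔ C (X ⊕ Z))
      (trans effect-X⊕Z (trans (cong (C ⊕_) (to (kernel⇔ Z) null)) (⊕-identityʳ C))))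
    (λ sol′ → from (kernel⇔ Z)
      (⊕-identityʳ-unique C (effect Z)
        (trans (sym effect-X⊕Z) (to (solution⇔ C (X ⊕ Z)) sol′))))
    where
    open Equivalence using (to; from)

    effect-X⊕Z : effect (X ⊕ Z) ≡ C ⊕ effect Z
    effect-X⊕Z = trans (effectOn-⊕ (allFin (β n)) X Z)
                       (cong (_⊕ effect Z) (to (solution⇔ C X) sol))

  allSolvable⇒effect-injective : (∀ C → Solvable C) → Injective _≡_ _≡_ effect
  allSolvable⇒effect-injective solvable =
    finite-surjective⇒injective (Subset↔Fin (β n)) λ C →
      let X , sol = solvable C in X , Equivalence.to (solution⇔ C X) sol

mainTheorem3 : ∀ (n : ℕ) → n ≥ 1 → let open Game n in
    ∀ (k : ℕ) → HasExactly k Kernel →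
    (∀ (C : Configuration) → Solvable C → HasExactly k (SolutionOf C))
    × (k > 1 → ∃ λ (C : Configuration) → ¬ Solvable C)
mainTheorem3 n _ k kernel = solutions , unsolvable kernel
  where
  open Game n

  solutions : ∀ C → Solvable C → HasExactly k (SolutionOf C)
  solutions C (X , sol) = HasExactly-↔ (⊕-↔ X) (kernel⇔solution n sol) kernel

  solvable? : Decidable Solvable
  solvable? C = anySubset? λ X → ≡-dec _≟_ (press X C) ⊥

  unsolvable : HasExactly k Kernel → k > 1 → ∃ λ C → ¬ Solvable C
  unsolvable ([]        , _ , refl , _) ()
  unsolvable (_ ∷ []    , _ , refl , _) (s≤s ())
  -- As `k > 1`, the list starts with two null sequences, distinct by uniqueness.
  unsolvable (X ∷ Y ∷ _ , (X≢Y ∷ _) ∷ _ , _ , ∈⇔K) _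
    -- Solvability is decidable by searching all button sets, so an unsolvable configuration can be
    -- searched for in turn.
    with anySubset? (¬? ∘ solvable?)
  ... | yes found = found
  ... | no  none  = contradiction
    -- If the search fails, `effect` is injective, yet it sends both `X` and `Y` to `⊥`.
    (allSolvable⇒effect-injective n
      (λ C → decidable-stable (solvable? C) (λ ¬sol → none (C , ¬sol)))
      (trans (null (here refl)) (sym (null (there (here refl))))))
    X≢Y
    where
    null : ∀ {Z} → Z ∈ X ∷ Y ∷ _ → effect n Z ≡ ⊥
    null Z∈ = Equivalence.to (kernel⇔ n _) (Equivalence.to (∈⇔K _) Z∈)
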